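{- For every integer $m>4$ there exist infinitely many integral closed 2-friezes of width $m$.
   Context: A closed 2-frieze of width $m$ is an array $a(r,c)$, with rows $r\in\{0,1,\dots,m+1\}$ (numbered from top to bottom) and columns $c\in\mathbb{Z}$ (numbered from left to right), whose top and bottom rows consist of 1s, i.e. $a(0,c)=a(m+1,c)=1$ for all $c\in\mathbb{Z}$, and which satisfies the local rule that every entry equals the determinant formed by its four neighbors: $$a(r,c)=a(r,c-1)\,a(r,c+1)-a(r-1,c)\,a(r+1,c)\qquad (1\le r\le m,\ c\in\mathbb{Z}).$$ A closed 2-frieze is integral if all its entries are positive integers. -}

module Defs where

open import Data.Fin using (Fin; zero; suc; fromℕ; inject₁)
open import Data.Integer using (ℤ; 0ℤ; 1ℤ; _+_; _-_; _*_; _<_)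
open import Data.Nat as ℕ using (ℕ)
open import Data.Product using (Σ; _×_; proj₁)
open import Function.Bundles using (Injection)
open import Level using (0ℓ)
open import Relation.Binary.Bundles using (Setoid)
import Relation.Binary.Construct.On as On
open import Relation.Binary.PropositionalEquality using (_≡_; refl; sym; trans)
import Relation.Binary.PropositionalEquality as ≡

-- Rows 0, …, m + 1.  Only integral friezes are of interest, so entries are
-- taken in ℤ; positivity is imposed separately in IsIntegral.
Array : ℕ → Set
Array m = Fin (2 ℕ.+ m) → ℤ → ℤ

-- An index i : Fin m stands for the interior row r = i + 1; the rows r - 1, r
-- and r + 1 are then the following.
above here below : ∀ {m} → Fin m → Fin (2 ℕ.+ m)
above i = inject₁ (inject₁ i)
here  i = suc (inject₁ i)
below i = suc (suc i)

record IsClosed2Frieze {m : ℕ} (a : Array m) : Set where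
  field
    top    : ∀ c → a zero c ≡ 1ℤ
    bottom : ∀ c → a (fromℕ (1 ℕ.+ m)) c ≡ 1ℤ
    local  : ∀ (i : Fin m) c →
             a (here i) c ≡
               a (here i) (c - 1ℤ) * a (here i) (c + 1ℤ)
                 - a (above i) c * a (below i) c

IsIntegral : ∀ {m} → Array m → Set
IsIntegral a = ∀ r c → 0ℤ < a r c

IntegralClosed2Frieze : ℕ → Set
IntegralClosed2Frieze m =
  Σ (Array m) λ a → IsClosed2Frieze a × IsIntegral a

arraySetoid : ℕ → Setoid 0ℓ 0ℓ
arraySetoid m = record
  { Carrier       = Array m
  ; _≈_           = λ a b → ∀ r c → a r c ≡ b r c
  ; isEquivalence = record
    { refl  = λ r c → refl
    ; sym   = λ p r c → sym (p r c)
    ; trans = λ p q r c → trans (p r c) (q r c)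
    }
  }

-- Friezes are equal when all their entries agree.
friezeSetoid : ℕ → Setoid 0ℓ 0ℓ
friezeSetoid m = On.setoid {B = IntegralClosed2Frieze m} (arraySetoid m) proj₁

Infinite : Setoid 0ℓ 0ℓ → Set
Infinite S = Injection (≡.setoid ℕ) S

-- A 2-frieze is read off a chain of vectors U z ∈ ℤ³ with U (z-1) × U (z+1) = U z
-- and U z · U (z+3) = 1: put a(r,c) = U (c-r) · U (c+r+3).  The local rule is then
-- the Binet–Cauchy identity, and the frieze of width m closes when U has period
-- 2n, n = m + 4.  Such chains come from n-periodic sequences V in ℤ³ whose
-- consecutive triples have determinant 1, by interleaving V i and V i × V (i+1).
--
-- By the local rule, two adjacent positive columns make all entries positive.
-- For n = 9 there is a polygon with coordinates linear in x and d whose consecutive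
-- determinants all equal x² + xd - d²; consecutive Fibonacci numbers make this
-- form 1, and two columns are visibly positive.  To pass from n to n + 1,
-- insert the unique vector w between the last vertex and the first that keeps
-- consecutive determinants 1: two adjacent columns of the new frieze are the old
-- ones with a 1 appended at the bottom.
module Submission where

open import Defs
open import Data.Nat using (ℕ; _>_)
open import Data.Fin using (Fin; zero; suc; fromℕ; inject₁; toℕ)
open import Data.Fin.Properties using (toℕ-fromℕ; toℕ-inject₁; toℕ≤pred[n])
open import Data.Fin.Relation.Unary.Top using (view; ‵fromℕ; ‵inj₁; ‵inject₁)
open import Data.Integer using (ℤ; +_; +[1+_]; -[1+_]; 0ℤ; 1ℤ; _+_; _-_; _*_; _<_; +<+)
import Data.Integer.Properties as ℤ
open import Data.Integer.Solver using (module +-*-Solver)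
import Data.Nat as ℕ
import Data.Nat.DivMod as ℕ
import Data.Nat.Properties as ℕ
open import Data.Nat.Tactic.RingSolver using (solve-∀)
open import Data.Product using (_×_; _,_; proj₁; proj₂)
open import Data.Sum using (inj₁; inj₂)
open import Function using (_∘_)
open import Relation.Binary.Definitions using (tri<; tri≈; tri>)
open import Relation.Binary.PropositionalEquality
open import Relation.Nullary using (contradiction)
open +-*-Solver using (Polynomial; solve; con; _:=_; _:+_; _:-_; _:*_)

-- Vector algebra in ℤ³.

record Vec₃ (A : Set) : Set where
  constructor ⟨_,_,_⟩
  field
    x₁ x₂ x₃ : A

open Vec₃

Vec₃-≡ : ∀ {A} {u v : Vec₃ A} → x₁ u ≡ x₁ v → x₂ u ≡ x₂ v → x₃ u ≡ x₃ v → u ≡ v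
Vec₃-≡ refl refl refl = refl

-- The operations are also needed on the solver's polynomials, where identities
-- between them are proved.
module Operations {A : Set} (_⊕_ _⊝_ _⊛_ : A → A → A) where

  infixl 6 _⊞_ _⊟_
  infixl 7 _•_ _⨯_ _⊡_

  _⊞_ _⊟_ _⨯_ : Vec₃ A → Vec₃ A → Vec₃ A
  ⟨ a₁ , a₂ , a₃ ⟩ ⊞ ⟨ b₁ , b₂ , b₃ ⟩ = ⟨ a₁ ⊕ b₁ , a₂ ⊕ b₂ , a₃ ⊕ b₃ ⟩
  ⟨ a₁ , a₂ , a₃ ⟩ ⊟ ⟨ b₁ , b₂ , b₃ ⟩ = ⟨ a₁ ⊝ b₁ , a₂ ⊝ b₂ , a₃ ⊝ b₃ ⟩
  ⟨ a₁ , a₂ , a₃ ⟩ ⨯ ⟨ b₁ , b₂ , b₃ ⟩ =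
    ⟨ (a₂ ⊛ b₃) ⊝ (a₃ ⊛ b₂) , (a₃ ⊛ b₁) ⊝ (a₁ ⊛ b₃) , (a₁ ⊛ b₂) ⊝ (a₂ ⊛ b₁) ⟩

  _⊡_ : A → Vec₃ A → Vec₃ A
  s ⊡ ⟨ a₁ , a₂ , a₃ ⟩ = ⟨ s ⊛ a₁ , s ⊛ a₂ , s ⊛ a₃ ⟩

  _•_ : Vec₃ A → Vec₃ A → A
  ⟨ a₁ , a₂ , a₃ ⟩ • ⟨ b₁ , b₂ , b₃ ⟩ = ((a₁ ⊛ b₁) ⊕ (a₂ ⊛ b₂)) ⊕ (a₃ ⊛ b₃)

  det : Vec₃ A → Vec₃ A → Vec₃ A → A
  det a b c = (a ⨯ b) • c

ℤ³ : Set
ℤ³ = Vec₃ ℤ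

open Operations {ℤ} _+_ _-_ _*_

open module Poly {n : ℕ} = Operations {Polynomial n} _:+_ _:-_ _:*_
  renaming (_⊞_ to _:⊞_; _⊟_ to _:⊟_; _⨯_ to _:⨯_; _⊡_ to _:⊡_; _•_ to _:•_; det to :det)

•-comm : ∀ a b → a • b ≡ b • a
•-comm ⟨ a₁ , a₂ , a₃ ⟩ ⟨ b₁ , b₂ , b₃ ⟩ =
  solve 6 (λ a₁ a₂ a₃ b₁ b₂ b₃ →
    ⟨ a₁ , a₂ , a₃ ⟩ :• ⟨ b₁ , b₂ , b₃ ⟩ := ⟨ b₁ , b₂ , b₃ ⟩ :• ⟨ a₁ , a₂ , a₃ ⟩)
    refl a₁ a₂ a₃ b₁ b₂ b₃

det-cycle : ∀ a b c → det a b c ≡ a • (b ⨯ c)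
det-cycle ⟨ a₁ , a₂ , a₃ ⟩ ⟨ b₁ , b₂ , b₃ ⟩ ⟨ c₁ , c₂ , c₃ ⟩ =
  solve 9 (λ a₁ a₂ a₃ b₁ b₂ b₃ c₁ c₂ c₃ →
    :det ⟨ a₁ , a₂ , a₃ ⟩ ⟨ b₁ , b₂ , b₃ ⟩ ⟨ c₁ , c₂ , c₃ ⟩
      := ⟨ a₁ , a₂ , a₃ ⟩ :• (⟨ b₁ , b₂ , b₃ ⟩ :⨯ ⟨ c₁ , c₂ , c₃ ⟩))
    refl a₁ a₂ a₃ b₁ b₂ b₃ c₁ c₂ c₃

binet-cauchy : ∀ a b c d →
  (a ⨯ b) • (c ⨯ d) ≡ (a • c) * (b • d) - (b • c) * (a • d)
binet-cauchy ⟨ a₁ , a₂ , a₃ ⟩ ⟨ b₁ , b₂ , b₃ ⟩ ⟨ c₁ , c₂ , c₃ ⟩ ⟨ d₁ , d₂ , d₃ ⟩ =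
  solve 12 (λ a₁ a₂ a₃ b₁ b₂ b₃ c₁ c₂ c₃ d₁ d₂ d₃ → let
      a = ⟨ a₁ , a₂ , a₃ ⟩
      b = ⟨ b₁ , b₂ , b₃ ⟩
      c = ⟨ c₁ , c₂ , c₃ ⟩
      d = ⟨ d₁ , d₂ , d₃ ⟩
    in (a :⨯ b) :• (c :⨯ d) := (a :• c) :* (b :• d) :- (b :• c) :* (a :• d))
    refl a₁ a₂ a₃ b₁ b₂ b₃ c₁ c₂ c₃ d₁ d₂ d₃

⨯-⨯ : ∀ a b c → (a ⨯ b) ⨯ (b ⨯ c) ≡ det a b c ⊡ b
⨯-⨯ ⟨ a₁ , a₂ , a₃ ⟩ ⟨ b₁ , b₂ , b₃ ⟩ ⟨ c₁ , c₂ , c₃ ⟩ = Vec₃-≡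
  (solve 9 (component x₁) refl a₁ a₂ a₃ b₁ b₂ b₃ c₁ c₂ c₃)
  (solve 9 (component x₂) refl a₁ a₂ a₃ b₁ b₂ b₃ c₁ c₂ c₃)
  (solve 9 (component x₃) refl a₁ a₂ a₃ b₁ b₂ b₃ c₁ c₂ c₃)
  where
  component : (Vec₃ (Polynomial 9) → Polynomial 9) → ∀ a₁ a₂ a₃ b₁ b₂ b₃ c₁ c₂ c₃ → _
  component xᵢ a₁ a₂ a₃ b₁ b₂ b₃ c₁ c₂ c₃ = let
      a = ⟨ a₁ , a₂ , a₃ ⟩
      b = ⟨ b₁ , b₂ , b₃ ⟩
      c = ⟨ c₁ , c₂ , c₃ ⟩
    in xᵢ ((a :⨯ b) :⨯ (b :⨯ c)) := xᵢ (:det a b c :⊡ b)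

⨯-⨯-unimodular : ∀ a b c → det a b c ≡ 1ℤ → (a ⨯ b) ⨯ (b ⨯ c) ≡ b
⨯-⨯-unimodular a b c abc=1 = trans (⨯-⨯ a b c) (trans (cong (_⊡ b) abc=1)
  (Vec₃-≡ (ℤ.*-identityˡ _) (ℤ.*-identityˡ _) (ℤ.*-identityˡ _)))

-- Interleaving vertices with cross products.

interleave : (ℕ → ℤ³) → ℕ → ℤ³
interleave V 0                 = V 0
interleave V 1                 = V 0 ⨯ V 1
interleave V (ℕ.suc (ℕ.suc k)) = interleave (V ∘ ℕ.suc) k

Unimodular : (ℕ → ℤ³) → Set
Unimodular V = ∀ i → det (V i) (V (1 ℕ.+ i)) (V (2 ℕ.+ i)) ≡ 1ℤ

-- For even `k` this is how the odd entries are defined; for odd `k`, two consecutive cross products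
-- meet in the vertex they share.
interleave-⨯ : ∀ {V} → Unimodular V → ∀ k →
  interleave V k ⨯ interleave V (2 ℕ.+ k) ≡ interleave V (1 ℕ.+ k)
interleave-⨯         V-unimodular 0                 = refl
interleave-⨯ {V = V} V-unimodular 1                 =
  ⨯-⨯-unimodular (V 0) (V 1) (V 2) (V-unimodular 0)
interleave-⨯         V-unimodular (ℕ.suc (ℕ.suc k)) = interleave-⨯ (V-unimodular ∘ ℕ.suc) k

-- For either parity of `k` the product is the determinant of three consecutive vertices, bracketed
-- in one of two ways.
interleave-• : ∀ {V} → Unimodular V → ∀ k →
  interleave V k • interleave V (3 ℕ.+ k) ≡ 1ℤ
interleave-• {V} V-unimodular 0                 =
  trans (sym (det-cycle (V 0) (V 1) (V 2))) (V-unimodular 0)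
interleave-•     V-unimodular 1                 = V-unimodular 0
interleave-•     V-unimodular (ℕ.suc (ℕ.suc k)) = interleave-• (V-unimodular ∘ ℕ.suc) k

-- The bound on `suc k` leaves out the entry 2n - 1, which is V (n - 1) ⨯ V n and so involves a
-- vertex beyond the first n.
interleave-cong-< : ∀ n {V W} → (∀ {i} → i ℕ.< n → V i ≡ W i) →
  ∀ {k} → ℕ.suc k ℕ.< n ℕ.* 2 → interleave V k ≡ interleave W k
interleave-cong-< (ℕ.suc n)         V≡W {0}                 _ = V≡W ℕ.z<s
interleave-cong-< 1                 V≡W {1}                 (ℕ.s≤s (ℕ.s≤s ()))
interleave-cong-< (ℕ.suc (ℕ.suc n)) V≡W {1}                 _ =
  cong₂ _⨯_ (V≡W ℕ.z<s) (V≡W (ℕ.s<s ℕ.z<s))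
interleave-cong-< (ℕ.suc n)         V≡W {ℕ.suc (ℕ.suc k)} (ℕ.s≤s (ℕ.s≤s k<n)) =
  interleave-cong-< n (V≡W ∘ ℕ.s<s) k<n

interleave-cong : ∀ {V W} → (∀ i → V i ≡ W i) → ∀ k → interleave V k ≡ interleave W k
interleave-cong V≡W 0                 = V≡W 0
interleave-cong V≡W 1                 = cong₂ _⨯_ (V≡W 0) (V≡W 1)
interleave-cong V≡W (ℕ.suc (ℕ.suc k)) = interleave-cong (V≡W ∘ ℕ.suc) k

interleave-shift : ∀ V j k →
  interleave V (j ℕ.* 2 ℕ.+ k) ≡ interleave (λ i → V (j ℕ.+ i)) k
interleave-shift V 0         k = refl
interleave-shift V (ℕ.suc j) k = interleave-shift (V ∘ ℕ.suc) j k

-- Cyclic sequences and their extension to ℤ.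

Periodic : ∀ {A : Set} → ℕ → (ℕ → A) → Set
Periodic n f = ∀ k → f (n ℕ.+ k) ≡ f k

interleave-periodic : ∀ {n V} → Periodic n V → Periodic (n ℕ.* 2) (interleave V)
interleave-periodic {n} {V} V-periodic k =
  trans (interleave-shift V n k) (interleave-cong V-periodic k)

[m+n%k]%k≡[m+n]%k : ∀ m n k .{{_ : ℕ.NonZero k}} →
  (m ℕ.+ n ℕ.% k) ℕ.% k ≡ (m ℕ.+ n) ℕ.% k
[m+n%k]%k≡[m+n]%k m n k = begin
  (m ℕ.+ r) ℕ.% k                  ≡⟨ ℕ.[m+kn]%n≡m%n (m ℕ.+ r) q k ⟨
  (m ℕ.+ r ℕ.+ q ℕ.* k) ℕ.% k      ≡⟨ cong (ℕ._% k) (ℕ.+-assoc m r _) ⟩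
  (m ℕ.+ (r ℕ.+ q ℕ.* k)) ℕ.% k    ≡⟨ cong (λ h → (m ℕ.+ h) ℕ.% k) (ℕ.m≡m%n+[m/n]*n n k) ⟨
  (m ℕ.+ n) ℕ.% k                  ∎
  where
  open ≡-Reasoning
  r = n ℕ.% k
  q = n ℕ./ k

wrap : ∀ {A : Set} (n : ℕ) .{{_ : ℕ.NonZero n}} → (ℕ → A) → ℕ → A
wrap n V i = V (i ℕ.% n)

wrap-periodic : ∀ {A : Set} n .{{_ : ℕ.NonZero n}} (V : ℕ → A) → Periodic n (wrap n V)
wrap-periodic n V k =
  cong V (trans (cong (ℕ._% n) (ℕ.+-comm n k)) (ℕ.[m+n]%n≡m%n k n))

wrap-< : ∀ {A : Set} n .{{_ : ℕ.NonZero n}} (V : ℕ → A) {i} → i ℕ.< n → wrap n V i ≡ V i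
wrap-< n V i<n = cong V (ℕ.m<n⇒m%n≡m i<n)

-- The vectors V₀, …, Vₗ₊₁ close up to a cyclic sequence of period l + 2.
ClosesAt : (ℕ → ℤ³) → ℕ → Set
ClosesAt V l = det (V l) (V (1 ℕ.+ l)) (V 0) ≡ 1ℤ × det (V (1 ℕ.+ l)) (V 0) (V 1) ≡ 1ℤ

-- Only the residues l and l + 1 start a triple that runs past the end; these are the two
-- determinants in `ClosesAt`.
wrap-unimodular : ∀ V l → Unimodular V → ClosesAt V l → Unimodular (wrap (2 ℕ.+ l) V)
wrap-unimodular V l V-unimodular (closes₁ , closes₂) i =
  subst₂ (UnimodularAt r) ([m+n%k]%k≡[m+n]%k 1 i n) ([m+n%k]%k≡[m+n]%k 2 i n)
    (residue r (ℕ.m<1+n⇒m≤n (ℕ.m%n<n i n)))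
  where
  n r : ℕ
  n = 2 ℕ.+ l
  r = i ℕ.% n

  UnimodularAt : ℕ → ℕ → ℕ → Set
  UnimodularAt i j k = det (V i) (V j) (V k) ≡ 1ℤ

  residue : ∀ r → r ℕ.≤ 1 ℕ.+ l → UnimodularAt r ((1 ℕ.+ r) ℕ.% n) ((2 ℕ.+ r) ℕ.% n)
  residue r r≤1+l with ℕ.m≤n⇒m<n∨m≡n r≤1+l
  ... | inj₂ refl = subst₂ (UnimodularAt r)
    (sym (ℕ.n%n≡0 n)) (sym (ℕ.[m+n]%n≡m%n 1 n)) closes₂
  ... | inj₁ (ℕ.s≤s r≤l) with ℕ.m≤n⇒m<n∨m≡n r≤l
  ...   | inj₂ refl = subst₂ (UnimodularAt r)
    (sym (ℕ.m<n⇒m%n≡m (ℕ.s<s (ℕ.s<s r≤l)))) (sym (ℕ.n%n≡0 n)) closes₁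
  ...   | inj₁ r<l = subst₂ (UnimodularAt r)
    (sym (ℕ.m<n⇒m%n≡m (ℕ.s<s (ℕ.s≤s r≤l)))) (sym (ℕ.m<n⇒m%n≡m (ℕ.s<s (ℕ.s<s r<l))))
    (V-unimodular r)

-- The period is 1 + p, so that -(1 + k) is congruent to (1 + k) p.
representative : ℕ → ℤ → ℕ
representative p (+ k)    = k
representative p -[1+ k ] = ℕ.suc k ℕ.* p

extend : ∀ {A : Set} → ℕ → (ℕ → A) → ℤ → A
extend p f z = f (representative p z)

-- At a negative argument, adding 1 lowers the representative by `p` instead of raising it by 1; the
-- two results differ by one period.
extend-suc : ∀ {A : Set} {p} {f : ℕ → A} → Periodic (1 ℕ.+ p) f → ∀ z →
  extend p f (z + 1ℤ) ≡ extend p (f ∘ ℕ.suc) z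
extend-suc {f = f} f-periodic (+ k)          = cong f (ℕ.+-comm k 1)
extend-suc         f-periodic -[1+ 0 ]       = sym (f-periodic 0)
extend-suc         f-periodic -[1+ ℕ.suc k ] = sym (f-periodic _)

extend-+ : ∀ {A : Set} {p} {f : ℕ → A} → Periodic (1 ℕ.+ p) f → ∀ z j →
  extend p f (z + + j) ≡ f (j ℕ.+ representative p z)
extend-+ {p = p} {f} f-periodic z 0         = cong (extend p f) (ℤ.+-identityʳ z)
extend-+ {p = p} {f} f-periodic z (ℕ.suc j) = begin
  extend p f (z + (1ℤ + + j))         ≡⟨ cong (extend p f) z+suc ⟩
  extend p f (z + + j + 1ℤ)           ≡⟨ extend-suc f-periodic (z + + j) ⟩
  extend p (f ∘ ℕ.suc) (z + + j)      ≡⟨ extend-+ f∘suc-periodic z j ⟩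
  f (ℕ.suc j ℕ.+ representative p z)  ∎
  where
  open ≡-Reasoning
  z+suc : z + (1ℤ + + j) ≡ z + + j + 1ℤ
  z+suc = solve 2 (λ z j → z :+ (con 1ℤ :+ j) := z :+ j :+ con 1ℤ) refl z (+ j)
  f∘suc-periodic : Periodic (1 ℕ.+ p) (f ∘ ℕ.suc)
  f∘suc-periodic k = trans (cong f (sym (ℕ.+-suc (1 ℕ.+ p) k))) (f-periodic (ℕ.suc k))

-- Closed friezes from periodic chains.

record SelfDual (N : ℕ) (U : ℤ → ℤ³) : Set where
  field
    ⨯-neighbours : ∀ z → U z ⨯ U (z + + 2) ≡ U (z + + 1)
    •-3          : ∀ z → U z • U (z + + 3) ≡ 1ℤ
    periodic     : ∀ z → U (z + + N) ≡ U z

extend-selfDual : ∀ n V → Periodic (1 ℕ.+ n) V → Unimodular V →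
  SelfDual ((1 ℕ.+ n) ℕ.* 2) (extend (1 ℕ.+ n ℕ.* 2) (interleave V))
extend-selfDual n V V-periodic V-unimodular = record
  { ⨯-neighbours = λ z → trans (cong (u (rep z) ⨯_) (U-+ z 2))
      (trans (interleave-⨯ V-unimodular (rep z)) (sym (U-+ z 1)))
  ; •-3 = λ z → trans (cong (u (rep z) •_) (U-+ z 3)) (interleave-• V-unimodular (rep z))
  ; periodic = λ z → trans (U-+ z (1 ℕ.+ p)) (u-periodic (rep z))
  }
  where
  p   = 1 ℕ.+ n ℕ.* 2
  u   = interleave V
  rep = representative p
  u-periodic : Periodic (1 ℕ.+ p) u
  u-periodic = interleave-periodic {1 ℕ.+ n} V-periodic
  U-+ : ∀ z j → extend p u (z + + j) ≡ u (j ℕ.+ rep z)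
  U-+ = extend-+ u-periodic

frieze : (ℤ → ℤ³) → (m : ℕ) → Array m
frieze U m r c = U (c - + toℕ r) • U (c + + toℕ r + + 3)

frieze-closed : ∀ {m U} → SelfDual ((4 ℕ.+ m) ℕ.* 2) U → IsClosed2Frieze (frieze U m)
frieze-closed {m} {U} U-selfDual = record { top = top ; bottom = bottom ; local = local }
  where
  open SelfDual U-selfDual

  a : Array m
  a = frieze U m

  U-cong₂ : ∀ {s s′ t t′} → s ≡ s′ → t ≡ t′ → U s • U t ≡ U s′ • U t′
  U-cong₂ = cong₂ (λ s t → U s • U t)

  top : ∀ c → a zero c ≡ 1ℤ
  top c = trans
    (U-cong₂ refl (solve 1 (λ c → c :+ con 0ℤ :+ con (+ 3) := c :- con 0ℤ :+ con (+ 3)) refl c))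
    (•-3 (c - 0ℤ))

  bottom : ∀ c → a (fromℕ (1 ℕ.+ m)) c ≡ 1ℤ
  bottom c = begin
    U (c - + toℕ (fromℕ (1 ℕ.+ m))) • U t′  ≡⟨ cong₂ (λ i j → U (c - + i) • U (c + + j + + 3)) eq eq ⟩
    U s • U t                               ≡⟨ •-comm (U s) (U t) ⟩
    -- The indices `s` and `t` of the bottom row are 2n - 3 apart; adding the period 2n to `s` puts
    -- it 3 after `t`.
    U t • U s                               ≡⟨ cong (U t •_) (periodic s) ⟨
    U t • U (s + + ((4 ℕ.+ m) ℕ.* 2))       ≡⟨ U-cong₂ refl s+N≡t+3 ⟩
    U t • U (t + + 3)                       ≡⟨ •-3 t ⟩
    1ℤ                                      ∎
    where
    open ≡-Reasoning
    eq = toℕ-fromℕ (1 ℕ.+ m)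
    t′ = c + + toℕ (fromℕ (1 ℕ.+ m)) + + 3
    s = c - + (1 ℕ.+ m)
    t = c + + (1 ℕ.+ m) + + 3
    s+N≡t+3 : s + + ((4 ℕ.+ m) ℕ.* 2) ≡ t + + 3
    s+N≡t+3 = trans (cong (λ N → s + N) (ℤ.pos-* (4 ℕ.+ m) 2))
      (solve 2 (λ c m → c :- (con 1ℤ :+ m) :+ (con (+ 4) :+ m) :* con (+ 2)
                      := c :+ (con 1ℤ :+ m) :+ con (+ 3) :+ con (+ 3)) refl c (+ m))

  local : ∀ (i : Fin m) c →
    a (here i) c ≡ a (here i) (c - 1ℤ) * a (here i) (c + 1ℤ) - a (above i) c * a (below i) c
  local i c rewrite toℕ-inject₁ (inject₁ i) | toℕ-inject₁ i = begin
    U (c - + ℕ.suc k) • U (c + + ℕ.suc k + + 3)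
      ≡⟨ U-cong₂ s+1 t+1 ⟩
    U (s + + 1) • U (t + + 1)
      ≡⟨ cong₂ _•_ (⨯-neighbours s) (⨯-neighbours t) ⟨
    (U s ⨯ U (s + + 2)) • (U t ⨯ U (t + + 2))
      ≡⟨ binet-cauchy (U s) (U (s + + 2)) (U t) (U (t + + 2)) ⟩
    (U s • U t) * (U (s + + 2) • U (t + + 2)) - (U (s + + 2) • U t) * (U s • U (t + + 2))
      ≡⟨ cong₂ _-_ (cong₂ _*_ (U-cong₂ left-s left-t) (U-cong₂ right-s right-t))
                   (cong₂ _*_ (U-cong₂ above-s refl) (U-cong₂ below-s below-t)) ⟩
    (U (c - 1ℤ - + ℕ.suc k) • U (c - 1ℤ + + ℕ.suc k + + 3))
      * (U (c + 1ℤ - + ℕ.suc k) • U (c + 1ℤ + + ℕ.suc k + + 3))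
      - (U (c - + k) • U (c + + k + + 3))
      * (U (c - + (2 ℕ.+ k)) • U (c + + (2 ℕ.+ k) + + 3)) ∎
    where
    open ≡-Reasoning
    k = toℕ i
    s = c - + 2 - + k
    t = c + + k + + 3
    s+1 : c - + ℕ.suc k ≡ s + + 1
    s+1 = solve 2 (λ c k → c :- (con 1ℤ :+ k) := c :- con (+ 2) :- k :+ con 1ℤ) refl c (+ k)
    t+1 : c + + ℕ.suc k + + 3 ≡ t + + 1
    t+1 = solve 2 (λ c k → c :+ (con 1ℤ :+ k) :+ con (+ 3)
      := c :+ k :+ con (+ 3) :+ con 1ℤ) refl c (+ k)
    left-s : s ≡ c - 1ℤ - + ℕ.suc k
    left-s = solve 2 (λ c k → c :- con (+ 2) :- k := c :- con 1ℤ :- (con 1ℤ :+ k)) refl c (+ k)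
    left-t : t ≡ c - 1ℤ + + ℕ.suc k + + 3
    left-t = solve 2 (λ c k → c :+ k :+ con (+ 3)
      := c :- con 1ℤ :+ (con 1ℤ :+ k) :+ con (+ 3)) refl c (+ k)
    right-s : s + + 2 ≡ c + 1ℤ - + ℕ.suc k
    right-s = solve 2 (λ c k → c :- con (+ 2) :- k :+ con (+ 2) := c :+ con 1ℤ :- (con 1ℤ :+ k)) refl c (+ k)
    right-t : t + + 2 ≡ c + 1ℤ + + ℕ.suc k + + 3
    right-t = solve 2 (λ c k → c :+ k :+ con (+ 3) :+ con (+ 2)
      := c :+ con 1ℤ :+ (con 1ℤ :+ k) :+ con (+ 3)) refl c (+ k)
    above-s : s + + 2 ≡ c - + k
    above-s = solve 2 (λ c k → c :- con (+ 2) :- k :+ con (+ 2) := c :- k) refl c (+ k)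
    below-s : s ≡ c - + (2 ℕ.+ k)
    below-s = solve 2 (λ c k → c :- con (+ 2) :- k := c :- (con (+ 2) :+ k)) refl c (+ k)
    below-t : t + + 2 ≡ c + + (2 ℕ.+ k) + + 3
    below-t = solve 2 (λ c k → c :+ k :+ con (+ 3) :+ con (+ 2)
      := c :+ (con (+ 2) :+ k) :+ con (+ 3)) refl c (+ k)

-- Propagation of positivity.

*-pos : ∀ {i j} → 0ℤ < i → 0ℤ < j → 0ℤ < i * j
*-pos {+[1+ _ ]} {+[1+ _ ]} _        _        = +<+ ℕ.z<s
*-pos {+ 0}                 (+<+ ()) _
*-pos {+[1+ _ ]} {+ 0}      _        (+<+ ())

scale-pos : ∀ n {i} → 0ℤ < i → 0ℤ < +[1+ n ] * i
scale-pos n = *-pos {+[1+ n ]} (+<+ ℕ.z<s)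

*-pos-cancelˡ : ∀ {i j} → 0ℤ < i → 0ℤ < i * j → 0ℤ < j
*-pos-cancelˡ {+[1+ n ]} {j} _ 0<ij =
  ℤ.*-cancelˡ-<-nonNeg +[1+ n ] (subst (_< +[1+ n ] * j) (sym (ℤ.*-zeroʳ +[1+ n ])) 0<ij)
*-pos-cancelˡ {+ 0} (+<+ ())

*-pos-cancelʳ : ∀ {i j} → 0ℤ < j → 0ℤ < i * j → 0ℤ < i
*-pos-cancelʳ {i} {j} 0<j 0<ij = *-pos-cancelˡ 0<j (subst (0ℤ <_) (ℤ.*-comm i j) 0<ij)

ℤ-induction : (P : ℤ → Set) → (∀ c → P c → P (c + 1ℤ)) → (∀ c → P (c + 1ℤ) → P c) →
  ∀ c₀ → P c₀ → ∀ c → P c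
ℤ-induction P up down c₀ Pc₀ c =
  subst P (solve 2 (λ c₀ c → c₀ :+ (c :- c₀) := c) refl c₀ c) (from-c₀ (c - c₀))
  where
  from-c₀ : ∀ z → P (c₀ + z)
  from-c₀ (+ 0)          = subst P (sym (ℤ.+-identityʳ c₀)) Pc₀
  from-c₀ (+[1+ n ])     = subst P
    (trans (ℤ.+-assoc c₀ (+ n) 1ℤ) (cong (λ k → c₀ + + k) (ℕ.+-comm n 1)))
    (up _ (from-c₀ (+ n)))
  from-c₀ -[1+ 0 ]       = down _ (subst P
    (sym (trans (ℤ.+-assoc c₀ -[1+ 0 ] 1ℤ) (ℤ.+-identityʳ c₀)))
    Pc₀)
  from-c₀ -[1+ ℕ.suc n ] = down _ (subst P
    (sym (ℤ.+-assoc c₀ -[1+ ℕ.suc n ] 1ℤ))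
    (from-c₀ -[1+ n ]))

PositiveColumn : ∀ {m} → Array m → ℤ → Set
PositiveColumn a c = ∀ r → 0ℤ < a r c

interior⇒column : ∀ {m} {a : Array m} → IsClosed2Frieze a → ∀ c →
  (∀ i → 0ℤ < a (here i) c) → PositiveColumn a c
interior⇒column a-closed c interior zero    =
  subst (0ℤ <_) (sym (IsClosed2Frieze.top a-closed c)) (+<+ ℕ.z<s)
interior⇒column a-closed c interior (suc j) with view j
... | ‵fromℕ     = subst (0ℤ <_) (sym (IsClosed2Frieze.bottom a-closed c)) (+<+ ℕ.z<s)
... | ‵inject₁ i = interior i

-- The local rule a(r,c-1) a(r,c+1) = a(r,c) + a(r-1,c) a(r+1,c) propagates
-- positivity in both directions.
positive-columns⇒integral : ∀ {m} {a : Array m} → IsClosed2Frieze a → ∀ c →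
  PositiveColumn a c → PositiveColumn a (c + 1ℤ) → IsIntegral a
positive-columns⇒integral {m} {a} a-closed c₀ pos₀ pos₁ r c =
  proj₁ (ℤ-induction Two up down c₀ (pos₀ , pos₁) c) r
  where
  open IsClosed2Frieze a-closed

  Two : ℤ → Set
  Two c = PositiveColumn a c × PositiveColumn a (c + 1ℤ)

  product : ∀ c → PositiveColumn a (c + 1ℤ) → ∀ i →
    0ℤ < a (here i) c * a (here i) (c + 1ℤ + 1ℤ)
  product c pos i = subst (0ℤ <_) eq
    (ℤ.+-mono-< (pos (here i)) (*-pos (pos (above i)) (pos (below i))))
    where
    open ≡-Reasoning
    u = a (above i) (c + 1ℤ) * a (below i) (c + 1ℤ)
    eq : a (here i) (c + 1ℤ) + u ≡ a (here i) c * a (here i) (c + 1ℤ + 1ℤ)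
    eq = begin
      a (here i) (c + 1ℤ) + u
        ≡⟨ cong (_+ u) (local i (c + 1ℤ)) ⟩
      a (here i) (c + 1ℤ - 1ℤ) * a (here i) (c + 1ℤ + 1ℤ) - u + u
        ≡⟨ solve 2 (λ p u → p :- u :+ u := p) refl _ u ⟩
      a (here i) (c + 1ℤ - 1ℤ) * a (here i) (c + 1ℤ + 1ℤ)
        ≡⟨ cong (λ z → a (here i) z * a (here i) (c + 1ℤ + 1ℤ))
             (solve 1 (λ c → c :+ con 1ℤ :- con 1ℤ := c) refl c) ⟩
      a (here i) c * a (here i) (c + 1ℤ + 1ℤ) ∎

  up : ∀ c → Two c → Two (c + 1ℤ)
  up c (pos , pos′) =
    pos′ , interior⇒column a-closed _ (λ i → *-pos-cancelˡ (pos (here i)) (product c pos′ i))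

  down : ∀ c → Two (c + 1ℤ) → Two c
  down c (pos , pos′) =
    interior⇒column a-closed _ (λ i → *-pos-cancelʳ (pos′ (here i)) (product c pos i)) , pos

-- Inserting a vertex.

-- The solution w of det p q w = det q w a = det w a b = 1, where p, q are the last
-- and a, b the first two vertices.
insert : ℤ³ → ℤ³ → ℤ³ → ℤ³ → ℤ³
insert p q a b = q ⊞ (1ℤ + det p q b) ⊡ a ⊟ b

-- A polynomial identity whose right-hand side becomes 1 once `det p q a` is 1.
det-pq-insert : ∀ p q a b → det p q (insert p q a b) ≡ det p q a + det p q b * (det p q a - 1ℤ)
det-pq-insert ⟨ p₁ , p₂ , p₃ ⟩ ⟨ q₁ , q₂ , q₃ ⟩ ⟨ a₁ , a₂ , a₃ ⟩ ⟨ b₁ , b₂ , b₃ ⟩ =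
  solve 12 (λ p₁ p₂ p₃ q₁ q₂ q₃ a₁ a₂ a₃ b₁ b₂ b₃ → let
      p = ⟨ p₁ , p₂ , p₃ ⟩
      q = ⟨ q₁ , q₂ , q₃ ⟩
      a = ⟨ a₁ , a₂ , a₃ ⟩
      b = ⟨ b₁ , b₂ , b₃ ⟩
    in :det p q (q :⊞ (con 1ℤ :+ :det p q b) :⊡ a :⊟ b)
         := :det p q a :+ :det p q b :* (:det p q a :- con 1ℤ))
    refl p₁ p₂ p₃ q₁ q₂ q₃ a₁ a₂ a₃ b₁ b₂ b₃

-- The multiple of `a` drops out because `a` is repeated, so `p` matters only through a scalar,
-- which the solver treats as a variable `s`.
det-q-insert-a : ∀ p q a b → det q (insert p q a b) a ≡ det q a b
det-q-insert-a p ⟨ q₁ , q₂ , q₃ ⟩ ⟨ a₁ , a₂ , a₃ ⟩ ⟨ b₁ , b₂ , b₃ ⟩ =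
  solve 10 (λ q₁ q₂ q₃ a₁ a₂ a₃ b₁ b₂ b₃ s → let
      q = ⟨ q₁ , q₂ , q₃ ⟩
      a = ⟨ a₁ , a₂ , a₃ ⟩
      b = ⟨ b₁ , b₂ , b₃ ⟩
    in :det q (q :⊞ (con 1ℤ :+ s) :⊡ a :⊟ b) a := :det q a b)
    refl q₁ q₂ q₃ a₁ a₂ a₃ b₁ b₂ b₃ (det p ⟨ q₁ , q₂ , q₃ ⟩ ⟨ b₁ , b₂ , b₃ ⟩)

det-insert-ab : ∀ p q a b → det (insert p q a b) a b ≡ det q a b
det-insert-ab p ⟨ q₁ , q₂ , q₃ ⟩ ⟨ a₁ , a₂ , a₃ ⟩ ⟨ b₁ , b₂ , b₃ ⟩ =
  solve 10 (λ q₁ q₂ q₃ a₁ a₂ a₃ b₁ b₂ b₃ s → let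
      q = ⟨ q₁ , q₂ , q₃ ⟩
      a = ⟨ a₁ , a₂ , a₃ ⟩
      b = ⟨ b₁ , b₂ , b₃ ⟩
    in :det (q :⊞ (con 1ℤ :+ s) :⊡ a :⊟ b) a b := :det q a b)
    refl q₁ q₂ q₃ a₁ a₂ a₃ b₁ b₂ b₃ (det p ⟨ q₁ , q₂ , q₃ ⟩ ⟨ b₁ , b₂ , b₃ ⟩)

-- The nonagons.

-- The vertices 0, 3 and 6 serve as the basis.  The coordinates come from the friezes
-- for which, in a cluster of Gr(3,9) with a double arrow between x and x + d, all
-- other variables are 1.
module Nonagon {A : Set} (_⊕_ _⊝_ _⊛_ : A → A → A) (κ : ℤ → A) where

  form : A → A → A
  form x d = ((x ⊛ x) ⊕ (x ⊛ d)) ⊝ (d ⊛ d)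

  nonagon : A → A → ℕ → Vec₃ A
  nonagon x d = λ where
      0 → ⟨ κ 1ℤ , κ 0ℤ , κ 0ℤ ⟩
      1 → ⟨ (4 ∙ x) ⊝ d , (7 ∙ x) ⊕ d , κ 0ℤ ⊝ (11 ∙ x) ⟩
      2 → ⟨ x , (2 ∙ x) ⊕ d , κ 0ℤ ⊝ ((3 ∙ x) ⊕ d) ⟩
      3 → ⟨ κ 0ℤ , κ 1ℤ , κ 0ℤ ⟩
      4 → ⟨ κ 0ℤ ⊝ ((4 ∙ x) ⊕ d) , (11 ∙ x) ⊝ (2 ∙ d) , (13 ∙ x) ⊕ (8 ∙ d) ⟩
      5 → ⟨ κ 0ℤ ⊝ ((3 ∙ x) ⊕ d) , (8 ∙ x) ⊝ d , (10 ∙ x) ⊕ (7 ∙ d) ⟩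
      6 → ⟨ κ 0ℤ , κ 0ℤ , κ 1ℤ ⟩
      7 → ⟨ (2 ∙ x) ⊕ d , κ 0ℤ ⊝ (5 ∙ x) , (8 ∙ x) ⊝ d ⟩
      -- This is vertex 8; larger indices are never evaluated.
      _ → ⟨ (5 ∙ x) ⊕ (3 ∙ d) , κ 0ℤ ⊝ ((12 ∙ x) ⊕ d) , (19 ∙ x) ⊝ d ⟩
    where
    infixl 7 _∙_
    _∙_ : ℕ → A → A
    k ∙ a = κ (+ k) ⊛ a

open Nonagon {ℤ} _+_ _-_ _*_ (λ k → k)

open module PolyNonagon {n : ℕ} = Nonagon {Polynomial n} _:+_ _:-_ _:*_ con
  renaming (form to :form; nonagon to :nonagon)

:triple : ℕ → ℕ → ℕ → (x d : Polynomial 2) → Polynomial 2 × Polynomial 2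
:triple i j k x d = let v = :nonagon x d in :det (v i) (v j) (v k) := :form x d

-- Friezes of every width from one nonagon.

splice : ∀ {A : Set} → ℕ → (ℕ → A) → (ℕ → A) → ℕ → A
splice 0         f g k         = g k
splice (ℕ.suc n) f g 0         = f 0
splice (ℕ.suc n) f g (ℕ.suc k) = splice n (f ∘ ℕ.suc) g k

module Family (x d : ℤ) (0<x : 0ℤ < x) (0<d : 0ℤ < d) (form≡1 : form x d ≡ 1ℤ) where

  V : ℕ → ℤ³
  V = nonagon x d

  -- An insertion depends on the last two vertices, so the recursion carries both: after `k`
  -- insertions, vertices 7 + k and 8 + k.
  last-two : ℕ → ℤ³ × ℤ³
  last-two 0         = V 7 , V 8
  last-two (ℕ.suc k) = let p , q = last-two k in q , insert p q (V 0) (V 1)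

  polygon : ℕ → ℤ³
  polygon = splice 7 V (proj₁ ∘ last-two)

  -- After an insertion both closing determinants reduce to the second of the previous two.
  polygon-closes : ∀ k → ClosesAt polygon (7 ℕ.+ k)
  polygon-closes 0 =
      trans (solve 2 (:triple 7 8 0) refl x d) form≡1
    , trans (solve 2 (:triple 8 0 1) refl x d) form≡1
  polygon-closes (ℕ.suc k) with last-two k | polygon-closes k
  ... | p , q | _ , qab≡1 =
      trans (det-q-insert-a p q (V 0) (V 1)) qab≡1
    , trans (det-insert-ab p q (V 0) (V 1)) qab≡1

  polygon-unimodular : Unimodular polygon
  polygon-unimodular 0 = trans (solve 2 (:triple 0 1 2) refl x d) form≡1
  polygon-unimodular 1 = trans (solve 2 (:triple 1 2 3) refl x d) form≡1
  polygon-unimodular 2 = trans (solve 2 (:triple 2 3 4) refl x d) form≡1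
  polygon-unimodular 3 = trans (solve 2 (:triple 3 4 5) refl x d) form≡1
  polygon-unimodular 4 = trans (solve 2 (:triple 4 5 6) refl x d) form≡1
  polygon-unimodular 5 = trans (solve 2 (:triple 5 6 7) refl x d) form≡1
  polygon-unimodular 6 = trans (solve 2 (:triple 6 7 8) refl x d) form≡1
  polygon-unimodular (ℕ.2+ (ℕ.2+ (ℕ.2+ (ℕ.suc k)))) with last-two k | polygon-closes k
  ... | p , q | pqa≡1 , _ = begin
    det p q (insert p q (V 0) (V 1))          ≡⟨ det-pq-insert p q (V 0) (V 1) ⟩
    det p q (V 0) + δ * (det p q (V 0) - 1ℤ)  ≡⟨ cong (λ h → h + δ * (h - 1ℤ)) pqa≡1 ⟩
    1ℤ + δ * 0ℤ                               ≡⟨ cong (λ h → 1ℤ + h) (ℤ.*-zeroʳ δ) ⟩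
    1ℤ                                        ∎
    where
    open ≡-Reasoning
    δ = det p q (V 1)

  chain : ℕ → ℤ → ℤ³
  -- `extend` takes the period less one, here 2(9 + k) - 1.
  chain k = extend (1 ℕ.+ (8 ℕ.+ k) ℕ.* 2) (interleave (wrap (9 ℕ.+ k) polygon))

  array : ∀ k → Array (5 ℕ.+ k)
  array k = frieze (chain k) (5 ℕ.+ k)

  array-closed : ∀ k → IsClosed2Frieze (array k)
  array-closed k = frieze-closed (extend-selfDual (8 ℕ.+ k) (wrap (9 ℕ.+ k) polygon)
    (wrap-periodic (9 ℕ.+ k) polygon)
    (wrap-unimodular polygon (7 ℕ.+ k) polygon-unimodular (polygon-closes k)))

  -- Away from the vector between the last vertex and the first one, the chain does
  -- not depend on k.
  window : ∀ k s → ℕ.suc s ℕ.< (9 ℕ.+ k) ℕ.* 2 → chain k (+ s) ≡ interleave polygon s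
  window k s s<n = interleave-cong-< (9 ℕ.+ k) (wrap-< (9 ℕ.+ k) polygon) s<n

  window-entry : ∀ k c r → r ℕ.≤ c → ℕ.suc (c ℕ.+ r ℕ.+ 3) ℕ.< (9 ℕ.+ k) ℕ.* 2 →
    chain k (+ c - + r) • chain k (+ c + + r + + 3)
      ≡ interleave polygon (c ℕ.∸ r) • interleave polygon (c ℕ.+ r ℕ.+ 3)
  window-entry k c r r≤c bound = cong₂ _•_
    (trans (cong (chain k) (trans (ℤ.m-n≡m⊖n c r) (ℤ.⊖-≥ r≤c)))
      (window k (c ℕ.∸ r) (ℕ.≤-<-trans (ℕ.s≤s c∸r≤t) bound)))
    (window k (c ℕ.+ r ℕ.+ 3) bound)
    where
    c∸r≤t : c ℕ.∸ r ℕ.≤ c ℕ.+ r ℕ.+ 3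
    c∸r≤t = ℕ.≤-trans (ℕ.m∸n≤m c r) (ℕ.≤-trans (ℕ.m≤m+n c r) (ℕ.m≤m+n _ 3))

  -- The extreme case c + r + 3 = 16 + 2k is the last index that `window` admits. Together with r ≤
  -- c this singles out columns 6 + k and 7 + k as those where all rows up to 6 + k lie in the
  -- window.
  window-bound : ∀ {k r c} → r ℕ.≤ 6 ℕ.+ k → c ℕ.≤ 7 ℕ.+ k →
    ℕ.suc (c ℕ.+ r ℕ.+ 3) ℕ.< (9 ℕ.+ k) ℕ.* 2
  window-bound {k} r≤6+k c≤7+k = ℕ.≤-trans
    (ℕ.s≤s (ℕ.s≤s (ℕ.+-monoˡ-≤ 3 (ℕ.+-mono-≤ c≤7+k r≤6+k))))
    (ℕ.≤-reflexive (total k))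
    where
    total : ∀ k → 2 ℕ.+ (7 ℕ.+ k ℕ.+ (6 ℕ.+ k) ℕ.+ 3) ≡ (9 ℕ.+ k) ℕ.* 2
    total = solve-∀

  0<form : 0ℤ < form x d
  0<form = subst (0ℤ <_) (sym form≡1) (+<+ ℕ.z<s)

  -- Each coefficient is one more than its argument, hence positive.
  quadratic : ℕ → ℕ → ℕ → ℤ
  quadratic a b c = +[1+ a ] * (x * x) + +[1+ b ] * (x * d) + +[1+ c ] * (d * d)

  quadratic-pos : ∀ a b c → 0ℤ < quadratic a b c
  quadratic-pos a b c = ℤ.+-mono-<
    (ℤ.+-mono-< (scale-pos a (*-pos 0<x 0<x)) (scale-pos b (*-pos 0<x 0<d)))
    (scale-pos c (*-pos 0<d 0<d))

  :quadratic : ℕ → ℕ → ℕ → Polynomial 2 → Polynomial 2 → Polynomial 2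
  :quadratic a b c x d =
    con +[1+ a ] :* (x :* x) :+ con +[1+ b ] :* (x :* d) :+ con +[1+ c ] :* (d :* d)

  -- Row r pairs the chain entries 6 - r and 9 + r; entry 2i is `V i` and entry 2i + 1 is
  -- `V i ⨯ V (1 + i)`. Each product is the form or a polynomial with positive coefficients.
  column-6 : PositiveColumn (array 0) (+ 6)
  column-6 = interior⇒column (array-closed 0) (+ 6) λ where
    zero → subst (0ℤ <_)
      (solve 2 (λ x d → let v = :nonagon x d in
        :form x d := (v 2 :⨯ v 3) :• v 5) refl x d)
      0<form
    (suc zero) → subst (0ℤ <_)
      (solve 2 (λ x d → let v = :nonagon x d in
        :quadratic 13 3 0 x d := v 2 :• (v 5 :⨯ v 6)) refl x d)
      (quadratic-pos 13 3 0)
    (suc (suc zero)) → subst (0ℤ <_)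
      (solve 2 (λ x d → let v = :nonagon x d in
        :form x d := (v 1 :⨯ v 2) :• v 6) refl x d)
      0<form
    (suc (suc (suc zero))) → subst (0ℤ <_)
      (solve 2 (λ x d → let v = :nonagon x d in
        :quadratic 33 3 0 x d := v 1 :• (v 6 :⨯ v 7)) refl x d)
      (quadratic-pos 33 3 0)
    (suc (suc (suc (suc zero)))) → subst (0ℤ <_)
      (solve 2 (λ x d → let v = :nonagon x d in
        :form x d := (v 0 :⨯ v 1) :• v 7) refl x d)
      0<form

  column-7 : PositiveColumn (array 0) (+ 7)
  column-7 = interior⇒column (array-closed 0) (+ 7) λ where
    zero → subst (0ℤ <_)
      (solve 2 (λ x d → let v = :nonagon x d in
        con (+ 3) :* x :+ d := v 3 :• (v 5 :⨯ v 6)) refl x d)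
      (ℤ.+-mono-< (scale-pos 2 0<x) 0<d)
    (suc zero) → subst (0ℤ <_)
      (solve 2 (λ x d → let v = :nonagon x d in
        x := (v 2 :⨯ v 3) :• v 6) refl x d)
      0<x
    (suc (suc zero)) → subst (0ℤ <_)
      (solve 2 (λ x d → let v = :nonagon x d in
        :quadratic 8 3 0 x d := v 2 :• (v 6 :⨯ v 7)) refl x d)
      (quadratic-pos 8 3 0)
    (suc (suc (suc zero))) → subst (0ℤ <_)
      (solve 2 (λ x d → let v = :nonagon x d in
        con (+ 5) :* x :* :form x d := (v 1 :⨯ v 2) :• v 7) refl x d)
      (*-pos (scale-pos 4 0<x) 0<form)
    (suc (suc (suc (suc zero)))) → subst (0ℤ <_)
      (solve 2 (λ x d → let v = :nonagon x d in
        (con (+ 7) :* x :+ d) :* :form x d := v 1 :• (v 7 :⨯ v 8)) refl x d)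
      (*-pos (ℤ.+-mono-< (scale-pos 6 0<x) 0<d) 0<form)

  widen-column : ∀ k c → 6 ℕ.+ k ℕ.≤ c → c ℕ.≤ 7 ℕ.+ k →
    PositiveColumn (array k) (+ c) → PositiveColumn (array (1 ℕ.+ k)) (+ c)
  widen-column k c 6+k≤c c≤7+k pos r with view r
  ... | ‵fromℕ     = subst (0ℤ <_)
    (sym (IsClosed2Frieze.bottom (array-closed (1 ℕ.+ k)) (+ c))) (+<+ ℕ.z<s)
  ... | ‵inject₁ i = subst (0ℤ <_) same (pos i)
    where
    open ≡-Reasoning
    i≤6+k = toℕ≤pred[n] i
    i≤c = ℕ.≤-trans i≤6+k 6+k≤c
    bound = window-bound {k} i≤6+k c≤7+k
    same : array k i (+ c) ≡ array (1 ℕ.+ k) (inject₁ i) (+ c)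
    same = begin
      array k i (+ c)
        ≡⟨ window-entry k c (toℕ i) i≤c bound ⟩
      interleave polygon (c ℕ.∸ toℕ i) • interleave polygon (c ℕ.+ toℕ i ℕ.+ 3)
        ≡⟨ window-entry (1 ℕ.+ k) c (toℕ i) i≤c (ℕ.≤-trans bound (ℕ.m≤n+m _ 2)) ⟨
      chain (1 ℕ.+ k) (+ c - + toℕ i) • chain (1 ℕ.+ k) (+ c + + toℕ i + + 3)
        ≡⟨ cong (λ r → chain (1 ℕ.+ k) (+ c - + r) • chain (1 ℕ.+ k) (+ c + + r + + 3))
             (toℕ-inject₁ i) ⟨
      array (1 ℕ.+ k) (inject₁ i) (+ c) ∎

  -- The pair of columns moves right by one with each insertion, so the induction hypothesis has to
  -- be positivity of the whole frieze rather than of two columns.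
  array-integral : ∀ k → IsIntegral (array k)
  array-integral 0         = positive-columns⇒integral (array-closed 0) (+ 6) column-6 column-7
  array-integral (ℕ.suc k) = positive-columns⇒integral (array-closed (ℕ.suc k)) (+ (6 ℕ.+ k))
    (widen-column k (6 ℕ.+ k) ℕ.≤-refl (ℕ.n≤1+n _) (λ r → array-integral k r (+ (6 ℕ.+ k))))
    (subst (PositiveColumn (array (ℕ.suc k))) (cong +_ (ℕ.+-comm 1 (6 ℕ.+ k)))
      (widen-column k (7 ℕ.+ k) (ℕ.n≤1+n _) ℕ.≤-refl (λ r → array-integral k r (+ (7 ℕ.+ k)))))

  -- This entry lies in the window for every `k`, so in each width it tells apart friezes with
  -- different `x`.
  entry-x : ∀ k → array k (suc (suc zero)) (+ 7) ≡ x
  entry-x k = trans (window-entry k 7 2 (ℕ.m≤m+n 2 5) (ℕ.m≤m+n 14 _))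
    (solve 2 (λ x d → let v = :nonagon x d in (v 2 :⨯ v 3) :• v 6 := x) refl x d)

-- Fibonacci seeds and infinitely many friezes.

record Seed : Set where
  field
    x d    : ℤ
    0<x    : 0ℤ < x
    0<d    : 0ℤ < d
    form≡1 : form x d ≡ 1ℤ

-- (x , d) runs through the pairs of Fibonacci numbers (F₂ₜ₊₁ , F₂ₜ₊₂).
seed : ℕ → Seed
seed 0 = record
  { x = 1ℤ ; d = 1ℤ ; 0<x = +<+ ℕ.z<s ; 0<d = +<+ ℕ.z<s ; form≡1 = refl }
seed (ℕ.suc t) = record
  { x      = x + d
  ; d      = x + d + d
  ; 0<x    = ℤ.+-mono-< 0<x 0<d
  ; 0<d    = ℤ.+-mono-< (ℤ.+-mono-< 0<x 0<d) 0<d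
  -- Advancing by two Fibonacci steps is a linear substitution that preserves the form.
  ; form≡1 = trans
      (solve 2 (λ x d → :form (x :+ d) (x :+ d :+ d) := :form x d) refl x d) form≡1
  }
  where open Seed (seed t)

seed-x-mono-< : ∀ {s t} → s ℕ.<′ t → Seed.x (seed s) < Seed.x (seed t)
seed-x-mono-< {s} ℕ.<′-base = increasing (seed s)
  where
  increasing : ∀ σ → Seed.x σ < Seed.x σ + Seed.d σ
  increasing σ = subst (_< Seed.x σ + Seed.d σ) (ℤ.+-identityʳ (Seed.x σ))
    (ℤ.+-monoʳ-< (Seed.x σ) (Seed.0<d σ))
seed-x-mono-< {s} (ℕ.<′-step {t} s<t) =
  ℤ.<-trans (seed-x-mono-< s<t) (seed-x-mono-< {t} ℕ.<′-base)

seed-x-injective : ∀ {s t} → Seed.x (seed s) ≡ Seed.x (seed t) → s ≡ t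
seed-x-injective {s} {t} xs≡xt with ℕ.<-cmp s t
... | tri< s<t _ _ = contradiction (seed-x-mono-< (ℕ.<⇒<′ s<t)) (ℤ.<-irrefl xs≡xt)
... | tri≈ _ s≡t _ = s≡t
... | tri> _ _ t<s = contradiction (seed-x-mono-< (ℕ.<⇒<′ t<s)) (ℤ.<-irrefl (sym xs≡xt))

theorem1 : ∀ (m : ℕ) → m > 4 → Infinite (friezeSetoid m)
theorem1 (ℕ.suc (ℕ.2+ (ℕ.2+ k))) _ = record
  { to        = λ t → let module F = Member t in
      F.array k , F.array-closed k , F.array-integral k
  ; cong      = λ { refl _ _ → refl }
  ; injective = λ {s} {t} same → seed-x-injective
      (trans (sym (Member.entry-x s k)) (trans (same (suc (suc zero)) (+ 7)) (Member.entry-x t k)))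
  }
  where
  module Member (t : ℕ) where
    open Seed (seed t)
    open Family x d 0<x 0<d form≡1 public
theorem1 1 (ℕ.s≤s ())
theorem1 2 (ℕ.s≤s (ℕ.s≤s ()))
theorem1 3 (ℕ.s≤s (ℕ.s≤s (ℕ.s≤s ())))
theorem1 4 (ℕ.s≤s (ℕ.s≤s (ℕ.s≤s (ℕ.s≤s ()))))
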